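{- Let $m$ be any positive integer. There exists a balanced weighing matrix with parameters $$\left(1+18\cdot\frac{9^{m+1}-1}{8},\ 9^{m+1},\ 4\cdot 9^m\right).$$
   Context: A weighing matrix of order $v$ and weight $k$ is a $(0,\pm1)$-matrix $W$ of order $v$ with $WW^\top=kI_v$. It is a balanced weighing matrix with parameters $(v,k,\lambda)$ if, in addition, the $(0,1)$-matrix obtained from $W$ by replacing every nonzero entry by $1$ is the incidence matrix of a symmetric $(v,k,\lambda)$ balanced incomplete block design, i.e. $\overline{W}\,\overline{W}^\top=(k-\lambda)I_v+\lambda J_v$, where $\overline{W}$ is the entrywise absolute value of $W$ and $J_v$ is the all-one matrix. Equivalently, $W$ is a $v\times v$ matrix over $\{0,1,-1\}$ with exactly $k$ nonzero entries in each row such that for any two distinct rows $i\neq j$ the multiset $\{w_{il}w_{jl}^{ -1}: w_{il}\neq0\neq w_{jl}\}$ contains each of $1$ and $-1$ exactly $\lambda/2$ times. -}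

module Defs where

open import Data.Nat using (ℕ; zero; suc)
open import Data.Fin using (Fin; zero; suc)
open import Data.Integer using (ℤ; +_; -_; _+_; _*_; ∣_∣; 0ℤ; 1ℤ)
open import Data.Product using (_×_; Σ)
open import Data.Sum using (_⊎_)
open import Relation.Binary.PropositionalEquality using (_≡_)
open import Relation.Nullary using (¬_)

Matrix : ℕ → Set
Matrix v = Fin v → Fin v → ℤ

∑ : ∀ {n} → (Fin n → ℤ) → ℤ
∑ {zero}  f = 0ℤ
∑ {suc n} f = f zero + ∑ (λ i → f (suc i))

mulT : ∀ {v} → Matrix v → Matrix v → Matrix v
mulT A B i j = ∑ (λ l → A i l * B j l)

absM : ∀ {v} → Matrix v → Matrix v
absM W i j = + ∣ W i j ∣

idM : ∀ {v} → Matrix v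
idM {suc _} zero    zero    = 1ℤ
idM {suc _} zero    (suc _) = 0ℤ
idM {suc _} (suc _) zero    = 0ℤ
idM {suc _} (suc i) (suc j) = idM i j

allOnes : ∀ {v} → Matrix v
allOnes _ _ = 1ℤ

IsZeroPM : ℤ → Set
IsZeroPM x = (x ≡ 0ℤ ⊎ x ≡ 1ℤ) ⊎ x ≡ - 1ℤ

IsWeighingMatrix : (v k : ℕ) → Matrix v → Set
IsWeighingMatrix v k W =
  (∀ i j → IsZeroPM (W i j)) ×
  (∀ i j → mulT W W i j ≡ (+ k) * idM i j)

IsBalancedWeighingMatrix : (v k λ' : ℕ) → Matrix v → Set
IsBalancedWeighingMatrix v k λ' W =
  IsWeighingMatrix v k W ×
  (∀ i j → mulT (absM W) (absM W) i j
             ≡ ((+ k) Data.Integer.- (+ λ')) * idM i j + (+ λ') * allOnes i j)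

BalancedWeighingMatrixExists : (v k λ' : ℕ) → Set
BalancedWeighingMatrixExists v k λ' = Σ (Matrix v) (IsBalancedWeighingMatrix v k λ')

{-# OPTIONS --safe #-}
-- A balanced weighing matrix with parameters (19, 9, 4) can be written as [0 R; 1 D],
-- where R is the 10 × 18 residual part and D the 9 × 18 derived part.  Let
-- N = (9^(m+1) - 1)/8.  Substituting the rows of D for the symbols of the simplex code
-- of length N over GF(9) gives 9^(m+1) rows, preceded by an entry 1.  The remaining
-- 10 N rows, preceded by an entry 0, come from substituting ±R₁ and ±R₂, two residual
-- parts for the same D, for the nonzero entries of a balanced generalized weighing
-- matrix of order N and weight 9^m over the Klein four-group {1, 2, 3, 4}.
-- Rows in different blocks are orthogonal because R₁ R₂ᵀ = 3C for a symmetric conference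
-- matrix C: Gram matrices of the four blocks depend only on the product of their
-- labels, and sum to zero over the group (to 18 J after taking absolute values).
-- The group matrix needs only the following property of the affine plane of order 3:
-- label the four directions by the Klein group; then for d ≠ 0 the product of the
-- directions of b + d and b is the identity for one b and every other element for two.

module Submission where

open import Defs

module Construction where

  open import Data.Bool.Base using (if_then_else_)
  open import Data.Fin.Base using (Fin; zero; suc; remQuot; combine; splitAt; _↑ˡ_; _↑ʳ_)
  open import Data.Fin.Patterns
  open import Data.Fin.Properties using (_≟_; all?; +↔⊎; *↔×; 1↔⊤; remQuot-combine)
  open import Data.Integer.Base using (ℤ; +_; -_; _+_; _*_; _-_; ∣_∣; 0ℤ; 1ℤ; -1ℤ)
  import Data.Integer.Properties as ℤ
  open import Data.Integer.Tactic.RingSolver using (solve-∀)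
  open import Data.Nat.Base as ℕ using (ℕ; zero; suc)
  import Data.Nat.DivMod as ℕ
  import Data.Nat.Properties as ℕ
  import Data.Nat.Tactic.RingSolver as ℕSolver
  open import Data.Product.Base using (_×_; _,_; uncurry)
  open import Data.Product.Function.NonDependent.Propositional using (_×-↔_)
  open import Data.Sum.Base using (_⊎_; inj₁; inj₂; [_,_]′)
  open import Data.Sum.Function.Propositional using (_⊎-↔_)
  import Data.Sum.Properties as Sum
  open import Data.Unit.Base using (⊤; tt)
  import Data.Unit.Properties as Unit
  open import Data.Vec.Base using (Vec; []; _∷_; lookup)
  open import Function.Base using (_∘_)
  open import Function.Bundles using (_↔_; _↣_; module Injection)
  open import Function.Properties.Inverse using (↔-refl; ↔-trans; ↔⇒↣)
  open import Relation.Binary.Definitions using (DecidableEquality)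
  open import Relation.Binary.PropositionalEquality
  open import Relation.Nullary using (Dec; yes; no; contradiction)
  open import Relation.Nullary.Decidable using (does; from-yes; _→-dec_; _⊎-dec_; dec-true; dec-false)

  open ≡-Reasoning

  -- Finite sums

  δ : ∀ {n} → Fin n → Fin n → ℤ
  δ i j = if does (i ≟ j) then 1ℤ else 0ℤ

  δ-refl : ∀ {n} (i : Fin n) → δ i i ≡ 1ℤ
  δ-refl i rewrite dec-true (i ≟ i) refl = refl

  δ-≢ : ∀ {n} {i j : Fin n} → i ≢ j → δ i j ≡ 0ℤ
  δ-≢ {i = i} {j} i≢j rewrite dec-false (i ≟ j) i≢j = refl

  +-congˡ : ∀ a {b c} → b ≡ c → a + b ≡ a + c
  +-congˡ a = cong (λ z → a + z)

  ∑-cong : ∀ {n} {f g : Fin n → ℤ} → (∀ i → f i ≡ g i) → ∑ f ≡ ∑ g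
  ∑-cong {zero}  f≗g = refl
  ∑-cong {suc n} f≗g = cong₂ _+_ (f≗g zero) (∑-cong (f≗g ∘ suc))

  ∑-affine : ∀ {n} b c (e : Fin n → ℤ) → ∑ (λ i → b + e i * c) ≡ + n * b + ∑ e * c
  ∑-affine {zero}  b c e = refl
  ∑-affine {suc n} b c e = begin
    (b + e zero * c) + ∑ (λ i → b + e (suc i) * c)         ≡⟨ +-congˡ (b + e zero * c) (∑-affine b c (e ∘ suc)) ⟩
    (b + e zero * c) + (+ n * b + ∑ (e ∘ suc) * c)         ≡⟨ regroup b c (e zero) (∑ (e ∘ suc)) (+ n) ⟩
    + suc n * b + ∑ e * c                                  ∎
    where
    regroup : ∀ b c e₀ s n → (b + e₀ * c) + (n * b + s * c) ≡ (1ℤ + n) * b + (e₀ + s) * c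
    regroup = solve-∀

  ∑-const : ∀ n c → ∑ {n} (λ _ → c) ≡ + n * c
  ∑-const zero    c = refl
  ∑-const (suc n) c = trans (+-congˡ c (∑-const n c)) (sym (ℤ.suc-* (+ n) c))

  ∑-*ʳ : ∀ {n} (e : Fin n → ℤ) c → ∑ (λ i → e i * c) ≡ ∑ e * c
  ∑-*ʳ {zero}  e c = refl
  ∑-*ʳ {suc n} e c = trans (+-congˡ (e zero * c) (∑-*ʳ (e ∘ suc) c)) (sym (ℤ.*-distribʳ-+ c (e zero) _))

  ∑-+ : ∀ {n} (f g : Fin n → ℤ) → ∑ (λ i → f i + g i) ≡ ∑ f + ∑ g
  ∑-+ {zero}  f g = refl
  ∑-+ {suc n} f g = trans (+-congˡ (f zero + g zero) (∑-+ (f ∘ suc) (g ∘ suc))) (interchange (f zero) (g zero) _ _)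
    where
    interchange : ∀ a b c d → (a + b) + (c + d) ≡ (a + c) + (b + d)
    interchange = solve-∀

  ∑-δ : ∀ {n} (i : Fin n) (f : Fin n → ℤ) → ∑ (λ k → δ i k * f k) ≡ f i
  ∑-δ {suc n} zero f = begin
    1ℤ * f zero + ∑ (λ k → 0ℤ * f (suc k)) ≡⟨ cong₂ _+_ (ℤ.*-identityˡ (f zero)) (∑-const n 0ℤ) ⟩
    f zero + + n * 0ℤ                      ≡⟨ +-congˡ (f zero) (ℤ.*-zeroʳ (+ n)) ⟩
    f zero + 0ℤ                            ≡⟨ ℤ.+-identityʳ (f zero) ⟩
    f zero                                 ∎
  ∑-δ {suc n} (suc i) f = trans (ℤ.+-identityˡ _) (∑-δ i (f ∘ suc))

  -- Grouping the terms by the value of `h` reduces sums over field elements to the multiplicities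
  -- with which the labels occur.
  ∑-fibres : ∀ {n k} (h : Fin n → Fin k) (f : Fin k → ℤ) →
             ∑ (λ b → f (h b)) ≡ ∑ (λ c → ∑ (λ b → δ (h b) c) * f c)
  ∑-fibres {zero}  {k} h f = sym (trans (∑-const k 0ℤ) (ℤ.*-zeroʳ (+ k)))
  ∑-fibres {suc n} h f = begin
    f (h zero) + ∑ (λ b → f (h (suc b)))
      ≡⟨ cong₂ _+_ (sym (∑-δ (h zero) f)) (∑-fibres (h ∘ suc) f) ⟩
    ∑ (λ c → δ (h zero) c * f c) + ∑ (λ c → ∑ (λ b → δ (h (suc b)) c) * f c)
      ≡⟨ sym (∑-+ (λ c → δ (h zero) c * f c) (λ c → ∑ (λ b → δ (h (suc b)) c) * f c)) ⟩
    ∑ (λ c → δ (h zero) c * f c + ∑ (λ b → δ (h (suc b)) c) * f c)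
      ≡⟨ ∑-cong (λ c → sym (ℤ.*-distribʳ-+ (f c) (δ (h zero) c) _)) ⟩
    ∑ (λ c → ∑ (λ b → δ (h b) c) * f c) ∎

  ∑-↑ : ∀ m {n} (f : Fin (m ℕ.+ n) → ℤ) → ∑ f ≡ ∑ (λ i → f (i ↑ˡ n)) + ∑ (λ j → f (m ↑ʳ j))
  ∑-↑ zero    f = sym (ℤ.+-identityˡ _)
  ∑-↑ (suc m) f = trans (+-congˡ (f zero) (∑-↑ m (f ∘ suc))) (sym (ℤ.+-assoc (f zero) _ _))

  ∑-combine : ∀ n {k} (f : Fin (n ℕ.* k) → ℤ) → ∑ f ≡ ∑ (λ i → ∑ (λ j → f (combine {n} {k} i j)))
  ∑-combine zero        f = refl
  ∑-combine (suc n) {k} f = trans (∑-↑ k f) (+-congˡ (∑ (λ j → f (combine {suc n} zero j))) (∑-combine n (λ c → f (k ↑ʳ c))))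

  -- The simplex code, the group matrix and the final matrix all consist of such rows, so one
  -- summation rule serves all three.
  bordered : ∀ {A : Set} {n k} → A → (Fin n → Fin k → A) → Fin (suc (n ℕ.* k)) → A
  bordered         a g zero    = a
  bordered {k = k} a g (suc c) = uncurry g (remQuot k c)

  ∑-bordered : ∀ {A B : Set} {n k} (F : A → B → ℤ) a (g : Fin n → Fin k → A) b (h : Fin n → Fin k → B) →
               ∑ (λ c → F (bordered a g c) (bordered b h c)) ≡ F a b + ∑ (λ i → ∑ (λ j → F (g i j) (h i j)))
  ∑-bordered {n = n} {k} F a g b h = +-congˡ (F a b) (trans (∑-combine n {k} _) (∑-cong λ i → ∑-cong λ j → entry i j))
    where
    entry : ∀ i j → F (uncurry g (remQuot k (combine i j))) (uncurry h (remQuot k (combine i j))) ≡ F (g i j) (h i j)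
    entry i j = cong (λ p → F (uncurry g p) (uncurry h p)) (remQuot-combine i j)

  -- The field GF(9) and the directions of its affine plane over GF(3)

  infixl 6 _+₃_ _⊕_ _⊖_
  infixl 7 _*₃_ _⊗_ _·_

  _+₃_ : Fin 3 → Fin 3 → Fin 3
  0F +₃ y  = y
  1F +₃ 0F = 1F
  1F +₃ 1F = 2F
  1F +₃ 2F = 0F
  2F +₃ 0F = 2F
  2F +₃ 1F = 0F
  2F +₃ 2F = 1F

  -₃_ : Fin 3 → Fin 3
  -₃ 0F = 0F
  -₃ 1F = 2F
  -₃ 2F = 1F

  _*₃_ : Fin 3 → Fin 3 → Fin 3
  0F *₃ _ = 0F
  1F *₃ y = y
  2F *₃ y = -₃ y

  -- The element a + bi, where i² = -1, has coordinates (a , b).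
  coords : Fin 9 → Fin 3 × Fin 3
  coords = remQuot {3} 3

  _⊕_ _⊖_ _⊗_ : Fin 9 → Fin 9 → Fin 9
  x ⊕ y = let (a , b) = coords x; (c , d) = coords y in combine (a +₃ c) (b +₃ d)
  x ⊖ y = let (a , b) = coords x; (c , d) = coords y in combine (a +₃ -₃ c) (b +₃ -₃ d)
  x ⊗ y = let (a , b) = coords x; (c , d) = coords y in combine (a *₃ c +₃ -₃ (b *₃ d)) (a *₃ d +₃ b *₃ c)

  -- Labels 1F to 4F are the lines through 0; 0F is the origin, which has no direction.
  dir : Fin 3 × Fin 3 → Fin 5
  dir (0F , 0F) = 0F
  dir (0F , _ ) = 1F
  dir (1F , 0F) = 2F
  dir (1F , 1F) = 3F
  dir (1F , 2F) = 4F
  dir (2F , 0F) = 2F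
  dir (2F , 1F) = 4F
  dir (2F , 2F) = 3F

  χ : Fin 9 → Fin 5
  χ x = dir (coords x)

  δ-⊕ : ∀ u v w → δ (u ⊕ w) (v ⊕ w) ≡ δ u v
  δ-⊕ = from-yes (all? λ u → all? λ v → all? λ w → δ (u ⊕ w) (v ⊕ w) ℤ.≟ δ u v)

  -- Moving `u` and `v` to one side leaves `∑-δ-⊗` three field elements to check exhaustively
  -- instead of four.
  δ-⊖ : ∀ u v s t → δ (u ⊕ s) (v ⊕ t) ≡ δ (u ⊖ v) (t ⊖ s)
  δ-⊖ = from-yes (all? λ u → all? λ v → all? λ s → all? λ t → δ (u ⊕ s) (v ⊕ t) ℤ.≟ δ (u ⊖ v) (t ⊖ s))

  -- For distinct `a` and `c` the difference c - a is invertible in GF(9), so its multiples by `b`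
  -- take every value once.
  ∑-δ-⊗ : ∀ a c w → δ a c ≡ 0ℤ → ∑ (λ b → δ w (c ⊗ b ⊖ a ⊗ b)) ≡ 1ℤ
  ∑-δ-⊗ = from-yes (all? λ a → all? λ c → all? λ w → (δ a c ℤ.≟ 0ℤ) →-dec (∑ (λ b → δ w (c ⊗ b ⊖ a ⊗ b)) ℤ.≟ 1ℤ))

  lines-meet-once : ∀ {a c} u v → a ≢ c → ∑ (λ b → δ (u ⊕ a ⊗ b) (v ⊕ c ⊗ b)) ≡ 1ℤ
  lines-meet-once {a} {c} u v a≢c =
    trans (∑-cong λ b → δ-⊖ u v (a ⊗ b) (c ⊗ b)) (∑-δ-⊗ a c (u ⊖ v) (δ-≢ a≢c))

  -- The simplex code

  pow9 : ℕ → ℤ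
  pow9 n = + (9 ℕ.^ n)

  -- The number (9^n - 1)/8 of points of the projective space of dimension n - 1 over GF(9), by
  -- Horner's rule, which matches the shape of `bordered`.
  points : ℕ → ℕ
  points zero    = 0
  points (suc n) = suc (points n ℕ.* 9)

  1+points*8 : ∀ n → 1 ℕ.+ points n ℕ.* 8 ≡ 9 ℕ.^ n
  1+points*8 zero    = refl
  1+points*8 (suc n) = trans (regroup (points n)) (cong (9 ℕ.*_) (1+points*8 n))
    where
    regroup : ∀ p → 1 ℕ.+ (1 ℕ.+ p ℕ.* 9) ℕ.* 8 ≡ 9 ℕ.* (1 ℕ.+ p ℕ.* 8)
    regroup = ℕSolver.solve-∀

  pow9-points : ∀ n → pow9 n ≡ 1ℤ + + points n * + 8
  pow9-points n = trans (cong +_ (sym (1+points*8 n))) (trans (ℤ.pos-+ 1 (points n ℕ.* 8)) (+-congˡ 1ℤ (ℤ.pos-* (points n) 8)))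

  pow9-suc : ∀ n → pow9 (suc n) ≡ + 9 * pow9 n
  pow9-suc n = ℤ.pos-* 9 (9 ℕ.^ n)

  pow9-scale : ∀ n u → pow9 n * (+ 9 * u) ≡ pow9 (suc n) * u
  pow9-scale n u = trans (regroup (pow9 n) u) (cong (_* u) (sym (pow9-suc n)))
    where
    regroup : ∀ p u → p * (+ 9 * u) ≡ + 9 * p * u
    regroup = solve-∀

  -- The codewords are the values of all linear forms at one representative of every
  -- point of projective space: (1 , 0) and the (b , z) with z a representative one
  -- dimension lower.
  simplex : ∀ n → Fin (9 ℕ.^ n) → Fin (points n) → Fin 9
  simplexRow : ∀ n → Fin 9 × Fin (9 ℕ.^ n) → Fin (points (suc n)) → Fin 9

  simplexRow n (a , x) = bordered a (λ j b → simplex n x j ⊕ a ⊗ b)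
  simplex (suc n) x = simplexRow n (remQuot {9} (9 ℕ.^ n) x)

  -- Distinct codewords of length (9^(n+1) - 1)/8 agree in (9^n - 1)/8 places; writing the
  -- value of F at an agreement as 8u keeps the totals free of division.
  simplex-same : ∀ n x {F : Fin 9 → Fin 9 → ℤ} {u} → (∀ c → F c c ≡ + 8 * u) →
                 u + ∑ (λ j → F (simplex n x j) (simplex n x j)) ≡ pow9 n * u
  simplex-same n x {F} {u} Fcc = begin
    u + ∑ (λ j → F (simplex n x j) (simplex n x j)) ≡⟨ +-congˡ u (trans (∑-cong λ j → Fcc (simplex n x j)) (∑-const (points n) (+ 8 * u))) ⟩
    u + + points n * (+ 8 * u)                      ≡⟨ regroup u (+ points n) ⟩
    (1ℤ + + points n * + 8) * u                     ≡⟨ cong (_* u) (sym (pow9-points n)) ⟩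
    pow9 n * u                                         ∎
    where
    regroup : ∀ u p → u + p * (+ 8 * u) ≡ (1ℤ + p * + 8) * u
    regroup = solve-∀

  -- The `points n` agreements contribute 8u each and the 9^n disagreements v each; as 8 times
  -- `points n` is 9^n - 1, the extra `u` completes the total.
  simplex-distinct : ∀ n {x y} → x ≢ y → ∀ {F : Fin 9 → Fin 9 → ℤ} {u v} →
                     (∀ c d → F c d ≡ v + δ c d * (+ 8 * u - v)) →
                     u + ∑ (λ j → F (simplex (suc n) x j) (simplex (suc n) y j)) ≡ pow9 n * (u + v)
  -- If the leading coefficients differ, each block of nine holds exactly one agreement. If they
  -- coincide, adding `a ⊗ b` to both entries preserves agreement, so summing over blocks gives the
  -- same claim one dimension lower, with `u` and `v` multiplied by 9.
  simplexRow-distinct : ∀ n {p q} → p ≢ q → ∀ {F : Fin 9 → Fin 9 → ℤ} {u v} →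
                        (∀ c d → F c d ≡ v + δ c d * (+ 8 * u - v)) →
                        u + ∑ (λ j → F (simplexRow n p j) (simplexRow n q j)) ≡ pow9 n * (u + v)

  simplex-distinct n x≢y {F} {u} {v} = simplexRow-distinct n (x≢y ∘ Injection.injective (↔⇒↣ *↔×)) {F} {u} {v}

  simplexRow-distinct n {a , x} {c , y} p≢q {F} {u} {v} Fcd with a ≟ c
  ... | no a≢c = begin
    u + ∑ (λ j → F (simplexRow n (a , x) j) (simplexRow n (c , y) j))
      ≡⟨ +-congˡ u (∑-bordered F a (λ j b → simplex n x j ⊕ a ⊗ b) c (λ j b → simplex n y j ⊕ c ⊗ b)) ⟩
    u + (F a c + ∑ (λ j → ∑ (λ b → F (simplex n x j ⊕ a ⊗ b) (simplex n y j ⊕ c ⊗ b))))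
      ≡⟨ +-congˡ u (cong₂ _+_ head (trans (∑-cong (λ j → block (simplex n x j) (simplex n y j))) (∑-const (points n) _))) ⟩
    u + (v + + points n * (+ 9 * v + 1ℤ * (+ 8 * u - v)))
      ≡⟨ regroup u v (+ points n) ⟩
    (1ℤ + + points n * + 8) * (u + v)
      ≡⟨ cong (_* (u + v)) (sym (pow9-points n)) ⟩
    pow9 n * (u + v) ∎
    where
    head : F a c ≡ v
    head = trans (Fcd a c) (trans (cong (λ z → v + z * (+ 8 * u - v)) (δ-≢ a≢c)) (ℤ.+-identityʳ v))
    block : ∀ s t → ∑ (λ b → F (s ⊕ a ⊗ b) (t ⊕ c ⊗ b)) ≡ + 9 * v + 1ℤ * (+ 8 * u - v)
    block s t = trans (∑-cong λ b → Fcd (s ⊕ a ⊗ b) (t ⊕ c ⊗ b))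
               (trans (∑-affine v (+ 8 * u - v) (λ b → δ (s ⊕ a ⊗ b) (t ⊕ c ⊗ b)))
                      (cong (λ z → + 9 * v + z * (+ 8 * u - v)) (lines-meet-once s t a≢c)))
    regroup : ∀ u v p → u + (v + p * (+ 9 * v + 1ℤ * (+ 8 * u - v))) ≡ (1ℤ + p * + 8) * (u + v)
    regroup = solve-∀
  -- `9 ^ 0` is 1, so equal leading coefficients leave only one codeword.
  simplexRow-distinct zero    {a , 0F} {.a , 0F} p≢q Fcd | yes refl = contradiction refl p≢q
  simplexRow-distinct (suc n) {a , x} {.a , y} p≢q {F} {u} {v} Fcd | yes refl = begin
    u + ∑ (λ j → F (simplexRow (suc n) (a , x) j) (simplexRow (suc n) (a , y) j))
      ≡⟨ +-congˡ u (∑-bordered F a (λ j b → simplex (suc n) x j ⊕ a ⊗ b) a (λ j b → simplex (suc n) y j ⊕ a ⊗ b)) ⟩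
    u + (F a a + ∑ (λ j → G (simplex (suc n) x j) (simplex (suc n) y j)))
      ≡⟨ sym (ℤ.+-assoc u (F a a) _) ⟩
    (u + F a a) + ∑ (λ j → G (simplex (suc n) x j) (simplex (suc n) y j))
      ≡⟨ cong (λ z → z + ∑ (λ j → G (simplex (suc n) x j) (simplex (suc n) y j))) head ⟩
    + 9 * u + ∑ (λ j → G (simplex (suc n) x j) (simplex (suc n) y j))
      -- The leading agreement has turned u into 9u, the extra summand that the induction hypothesis
      -- for `G` asks for.
      ≡⟨ simplex-distinct n (λ x≡y → p≢q (cong (a ,_) x≡y)) {G} {+ 9 * u} {+ 9 * v} Gcd ⟩
    pow9 n * (+ 9 * u + + 9 * v)
      ≡⟨ regroup (pow9 n) u v ⟩
    + 9 * pow9 n * (u + v)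
      ≡⟨ cong (_* (u + v)) (sym (pow9-suc n)) ⟩
    pow9 (suc n) * (u + v) ∎
    where
    G : Fin 9 → Fin 9 → ℤ
    G c d = ∑ (λ b → F (c ⊕ a ⊗ b) (d ⊕ a ⊗ b))
    regroup₁ : ∀ u v → u + (v + 1ℤ * (+ 8 * u - v)) ≡ + 9 * u
    regroup₁ = solve-∀
    head : u + F a a ≡ + 9 * u
    head = trans (+-congˡ u (trans (Fcd a a) (cong (λ z → v + z * (+ 8 * u - v)) (δ-refl a)))) (regroup₁ u v)
    regroup₂ : ∀ u v d → + 9 * (v + d * (+ 8 * u - v)) ≡ + 9 * v + d * (+ 8 * (+ 9 * u) - + 9 * v)
    regroup₂ = solve-∀
    Gcd : ∀ c d → G c d ≡ + 9 * v + δ c d * (+ 8 * (+ 9 * u) - + 9 * v)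
    Gcd c d = trans (∑-cong (λ b → trans (Fcd (c ⊕ a ⊗ b) (d ⊕ a ⊗ b)) (cong (λ z → v + z * (+ 8 * u - v)) (δ-⊕ c d (a ⊗ b)))))
             (trans (∑-const 9 _) (regroup₂ u v (δ c d)))
    regroup : ∀ p u v → p * (+ 9 * u + + 9 * v) ≡ + 9 * p * (u + v)
    regroup = solve-∀

  -- A balanced generalized weighing matrix over the Klein four-group

  -- The Klein four-group with identity `1F`, extended by an absorbing zero `0F`.
  _·_ : Fin 5 → Fin 5 → Fin 5
  0F · _  = 0F
  1F · l  = l
  2F · 0F = 0F
  2F · 1F = 2F
  2F · 2F = 1F
  2F · 3F = 4F
  2F · 4F = 3F
  3F · 0F = 0F
  3F · 1F = 3F
  3F · 2F = 4F
  3F · 3F = 1F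
  3F · 4F = 2F
  4F · 0F = 0F
  4F · 1F = 4F
  4F · 2F = 3F
  4F · 3F = 2F
  4F · 4F = 1F

  ·-comm : ∀ k l → k · l ≡ l · k
  ·-comm = from-yes (all? λ k → all? λ l → k · l ≟ l · k)

  ι : Fin 5 → ℤ
  ι zero    = 0ℤ
  ι (suc _) = 1ℤ

  ∑-ι-χ : ∀ c → ∑ (λ b → ι (χ (c ⊖ b))) ≡ + 8
  ∑-ι-χ = from-yes (all? λ c → ∑ (λ b → ι (χ (c ⊖ b))) ℤ.≟ + 8)

  -- `c ⊖ b` runs through the whole field, each line through 0 has two nonzero points, and
  -- multiplication by a nonzero `k` permutes the group.
  χ-translates : ∀ k c l → ∑ (λ b → δ (k · χ (c ⊖ b)) (suc l)) ≡ ι k * + 2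
  χ-translates = from-yes (all? λ k → all? λ c → all? λ l → ∑ (λ b → δ (k · χ (c ⊖ b)) (suc l)) ℤ.≟ ι k * + 2)

  -- For distinct `c` and `d`, the third point of their line gives equal directions, hence the
  -- identity. The six points off the line realise once each ordered pair of distinct directions
  -- other than that of the line, and any three distinct group elements have the three nonidentity
  -- elements as pairwise products. For equal `c` and `d`, eight labels square to the identity.
  χ-differences : ∀ c d l → ∑ (λ b → δ (χ (c ⊖ b) · χ (d ⊖ b)) (suc l)) ≡ (+ 2 - δ 0F l) + δ c d * (+ 9 * δ 0F l - + 2)
  χ-differences = from-yes (all? λ c → all? λ d → all? λ l →
    ∑ (λ b → δ (χ (c ⊖ b) · χ (d ⊖ b)) (suc l)) ℤ.≟ (+ 2 - δ 0F l) + δ c d * (+ 9 * δ 0F l - + 2))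

  -- A set of size `points (suc n)`, split into the points at infinity, which form the space one
  -- dimension lower, and the affine points, which index codewords.
  Point : ℕ → Set
  Point zero    = ⊤
  Point (suc n) = Point n ⊎ Fin (9 ℕ.^ suc n)

  _≟ₚ_ : ∀ {n} → DecidableEquality (Point n)
  _≟ₚ_ {zero}  = Unit._≟_
  _≟ₚ_ {suc n} = Sum.≡-dec _≟ₚ_ _≟_

  -- `bgw 1` borders the 9 × 9 matrix of directions to a matrix of order 10 and weight 9. Further
  -- steps substitute its derived part and its residual part, a constant row, just as the final
  -- construction does with the matrix of order 19.
  bgw : ∀ n → Point n → Fin (points (suc n)) → Fin 5
  bgw zero    _        = λ _ → 1F
  bgw (suc n) (inj₁ i) = bordered 0F (λ j _ → bgw n i j)
  bgw (suc n) (inj₂ x) = bordered 1F (λ j b → χ (simplex (suc n) x j ⊖ b))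

  ∑-bordered₁ : ∀ {A : Set} {n k} (F : A → ℤ) a (g : Fin n → Fin k → A) →
                ∑ (λ c → F (bordered a g c)) ≡ F a + ∑ (λ i → ∑ (λ j → F (g i j)))
  ∑-bordered₁ F a g = ∑-bordered (λ x _ → F x) a g a g

  bgw-weight : ∀ n i → ∑ (λ j → ι (bgw n i j)) ≡ pow9 n
  bgw-weight zero    _        = refl
  bgw-weight (suc n) (inj₁ i) = begin
    ∑ (λ j → ι (bgw (suc n) (inj₁ i) j))                ≡⟨ ∑-bordered₁ {k = 9} ι 0F (λ j _ → bgw n i j) ⟩
    0ℤ + ∑ (λ j → ∑ {9} (λ _ → ι (bgw n i j)))          ≡⟨ ℤ.+-identityˡ _ ⟩
    ∑ (λ j → ∑ {9} (λ _ → ι (bgw n i j)))               ≡⟨ ∑-cong (λ j → trans (∑-const 9 (ι (bgw n i j))) (ℤ.*-comm (+ 9) (ι (bgw n i j)))) ⟩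
    ∑ (λ j → ι (bgw n i j) * + 9)                       ≡⟨ ∑-*ʳ (λ j → ι (bgw n i j)) (+ 9) ⟩
    ∑ (λ j → ι (bgw n i j)) * + 9                       ≡⟨ cong (_* + 9) (bgw-weight n i) ⟩
    pow9 n * + 9                                           ≡⟨ trans (ℤ.*-comm (pow9 n) (+ 9)) (sym (pow9-suc n)) ⟩
    pow9 (suc n)                                           ∎
  bgw-weight (suc n) (inj₂ x) = begin
    ∑ (λ j → ι (bgw (suc n) (inj₂ x) j))                               ≡⟨ ∑-bordered₁ ι 1F (λ j b → χ (simplex (suc n) x j ⊖ b)) ⟩
    1ℤ + ∑ (λ j → ∑ (λ b → ι (χ (simplex (suc n) x j ⊖ b))))           ≡⟨ +-congˡ 1ℤ (∑-cong λ j → ∑-ι-χ (simplex (suc n) x j)) ⟩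
    -- Each symbol brings eight nonzero labels, so `simplex-same` applies with a constant `F` and
    -- the border entry as u = 1.
    1ℤ + ∑ {points (suc n)} (λ _ → + 8)                                ≡⟨ simplex-same (suc n) x {λ _ _ → + 8} {1ℤ} (λ _ → refl) ⟩
    pow9 (suc n) * 1ℤ                                                     ≡⟨ ℤ.*-identityʳ (pow9 (suc n)) ⟩
    pow9 (suc n)                                                          ∎

  -- Evaluation at an arbitrary `f` replaces computation in the group ring. The application takes
  -- `f k` to be an inner product of residual rows from the blocks labelled `k` and `1F`.
  module _ (f : Fin 5 → ℤ) (f0 : f 0F ≡ 0ℤ) where

    private
      σ : ℤ
      σ = ∑ (λ l → f (suc l))

      fibres : ∀ (h : Fin 9 → Fin 5) → ∑ (λ b → f (h b)) ≡ ∑ (λ l → ∑ (λ b → δ (h b) (suc l)) * f (suc l))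
      fibres h = begin
        ∑ (λ b → f (h b))                          ≡⟨ ∑-fibres h f ⟩
        ∑ (λ b → δ (h b) 0F) * f 0F + nonzero      ≡⟨ cong (λ z → ∑ (λ b → δ (h b) 0F) * z + nonzero) f0 ⟩
        ∑ (λ b → δ (h b) 0F) * 0ℤ + nonzero        ≡⟨ cong (λ z → z + nonzero) (ℤ.*-zeroʳ (∑ (λ b → δ (h b) 0F))) ⟩
        0ℤ + nonzero                               ≡⟨ ℤ.+-identityˡ nonzero ⟩
        nonzero                                    ∎
        where
        nonzero : ℤ
        nonzero = ∑ (λ l → ∑ (λ b → δ (h b) (suc l)) * f (suc l))

    ∑-translates : ∀ k c → ∑ (λ b → f (k · χ (c ⊖ b))) ≡ ι k * (σ * + 2)
    ∑-translates k c = begin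
      ∑ (λ b → f (k · χ (c ⊖ b)))                                        ≡⟨ fibres (λ b → k · χ (c ⊖ b)) ⟩
      ∑ (λ l → ∑ (λ b → δ (k · χ (c ⊖ b)) (suc l)) * f (suc l))          ≡⟨ ∑-cong (λ l → cong (_* f (suc l)) (χ-translates k c l)) ⟩
      ∑ (λ l → ι k * + 2 * f (suc l))                                    ≡⟨ expand (ι k) (f 1F) (f 2F) (f 3F) (f 4F) ⟩
      ι k * (σ * + 2)                                                    ∎
      where
      expand : ∀ i p q r s → i * + 2 * p + (i * + 2 * q + (i * + 2 * r + (i * + 2 * s + 0ℤ))) ≡ i * ((p + (q + (r + (s + 0ℤ)))) * + 2)
      expand = solve-∀

    -- Put in the form that `simplex-distinct` expects, with u = `f 1F` and v = `σ * + 2 - f 1F`.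
    ∑-differences : ∀ c d → ∑ (λ b → f (χ (c ⊖ b) · χ (d ⊖ b))) ≡
                    (σ * + 2 - f 1F) + δ c d * (+ 8 * f 1F - (σ * + 2 - f 1F))
    ∑-differences c d = begin
      ∑ (λ b → f (χ (c ⊖ b) · χ (d ⊖ b)))
        ≡⟨ fibres (λ b → χ (c ⊖ b) · χ (d ⊖ b)) ⟩
      ∑ (λ l → ∑ (λ b → δ (χ (c ⊖ b) · χ (d ⊖ b)) (suc l)) * f (suc l))
        ≡⟨ ∑-cong (λ l → cong (_* f (suc l)) (χ-differences c d l)) ⟩
      ∑ (λ l → ((+ 2 - δ 0F l) + δ c d * (+ 9 * δ 0F l - + 2)) * f (suc l))
        ≡⟨ expand (δ c d) (f 1F) (f 2F) (f 3F) (f 4F) ⟩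
      (σ * + 2 - f 1F) + δ c d * (+ 8 * f 1F - (σ * + 2 - f 1F)) ∎
      where
      -- `δ 0F l` is 1 at the identity and 0 at the other three elements, which makes the
      -- coefficients 1 + 7e and 2 - 2e.
      expand : ∀ e p q r s →
        (1ℤ + e * + 7) * p + ((+ 2 + e * - + 2) * q + ((+ 2 + e * - + 2) * r + ((+ 2 + e * - + 2) * s + 0ℤ))) ≡
        ((p + (q + (r + (s + 0ℤ)))) * + 2 - p) + e * (+ 8 * p - ((p + (q + (r + (s + 0ℤ)))) * + 2 - p))
      expand = solve-∀

    -- For n ≥ 1 the products of two distinct rows take each group element 2 * 9^(n-1) times, and
    -- the hypothesis on `σ` turns this into 9^n β; for n = 0 there is a single row.
    bgw-distinct : ∀ {β} → σ * + 2 ≡ + 9 * β → ∀ n {i i′} → i ≢ i′ →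
                   ∑ (λ j → f (bgw n i j · bgw n i′ j)) ≡ pow9 n * β
    bgw-distinct {β} total = go
      where
      cross : ∀ n i x → ∑ (λ j → f (bgw (suc n) (inj₁ i) j · bgw (suc n) (inj₂ x) j)) ≡ pow9 (suc n) * β
      cross n i x = begin
        ∑ (λ j → f (bgw (suc n) (inj₁ i) j · bgw (suc n) (inj₂ x) j))
          ≡⟨ ∑-bordered (λ k l → f (k · l)) 0F (λ j _ → bgw n i j) 1F (λ j b → χ (simplex (suc n) x j ⊖ b)) ⟩
        f 0F + ∑ (λ j → ∑ (λ b → f (bgw n i j · χ (simplex (suc n) x j ⊖ b))))
          ≡⟨ cong₂ _+_ f0 (∑-cong λ j → ∑-translates (bgw n i j) (simplex (suc n) x j)) ⟩
        0ℤ + ∑ (λ j → ι (bgw n i j) * (σ * + 2))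
          ≡⟨ trans (ℤ.+-identityˡ _) (∑-*ʳ (λ j → ι (bgw n i j)) (σ * + 2)) ⟩
        ∑ (λ j → ι (bgw n i j)) * (σ * + 2)
          ≡⟨ cong₂ _*_ (bgw-weight n i) total ⟩
        pow9 n * (+ 9 * β)
          ≡⟨ pow9-scale n β ⟩
        pow9 (suc n) * β ∎

      go : ∀ n {i i′} → i ≢ i′ → ∑ (λ j → f (bgw n i j · bgw n i′ j)) ≡ pow9 n * β
      go zero    {tt} {tt} i≢i′ = contradiction refl i≢i′
      go (suc n) {inj₁ i} {inj₁ i′} i≢i′ = begin
        ∑ (λ j → f (bgw (suc n) (inj₁ i) j · bgw (suc n) (inj₁ i′) j))
          ≡⟨ ∑-bordered {k = 9} (λ k l → f (k · l)) 0F (λ j _ → bgw n i j) 0F (λ j _ → bgw n i′ j) ⟩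
        f 0F + ∑ (λ j → ∑ {9} (λ _ → f (bgw n i j · bgw n i′ j)))
          ≡⟨ cong₂ _+_ f0 (∑-cong λ j → trans (∑-const 9 _) (ℤ.*-comm (+ 9) (f (bgw n i j · bgw n i′ j)))) ⟩
        0ℤ + ∑ (λ j → f (bgw n i j · bgw n i′ j) * + 9)
          ≡⟨ trans (ℤ.+-identityˡ _) (∑-*ʳ (λ j → f (bgw n i j · bgw n i′ j)) (+ 9)) ⟩
        ∑ (λ j → f (bgw n i j · bgw n i′ j)) * + 9
          ≡⟨ cong (_* + 9) (go n (i≢i′ ∘ cong inj₁)) ⟩
        pow9 n * β * + 9
          ≡⟨ regroup (pow9 n) β ⟩
        + 9 * pow9 n * β
          ≡⟨ cong (_* β) (sym (pow9-suc n)) ⟩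
        pow9 (suc n) * β ∎
        where
        regroup : ∀ p b → p * b * + 9 ≡ + 9 * p * b
        regroup = solve-∀
      go (suc n) {inj₁ i} {inj₂ x} _ = cross n i x
      go (suc n) {inj₂ x} {inj₁ i} _ =
        trans (∑-cong λ j → cong f (·-comm (bgw (suc n) (inj₂ x) j) (bgw (suc n) (inj₁ i) j))) (cross n i x)
      go (suc n) {inj₂ x} {inj₂ y} x≢y = begin
        ∑ (λ j → f (bgw (suc n) (inj₂ x) j · bgw (suc n) (inj₂ y) j))
          ≡⟨ ∑-bordered (λ k l → f (k · l)) 1F (λ j b → χ (simplex (suc n) x j ⊖ b)) 1F (λ j b → χ (simplex (suc n) y j ⊖ b)) ⟩
        f 1F + ∑ (λ j → ∑ (λ b → f (χ (simplex (suc n) x j ⊖ b) · χ (simplex (suc n) y j ⊖ b))))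
          ≡⟨ simplex-distinct n (x≢y ∘ cong inj₂) {_} {f 1F} {σ * + 2 - f 1F} ∑-differences ⟩
        pow9 n * (f 1F + (σ * + 2 - f 1F))
          ≡⟨ regroup (pow9 n) (f 1F) (σ * + 2) ⟩
        pow9 n * (σ * + 2)
          ≡⟨ cong (pow9 n *_) total ⟩
        pow9 n * (+ 9 * β)
          ≡⟨ pow9-scale n β ⟩
        pow9 (suc n) * β ∎
        where
        regroup : ∀ p a b → p * (a + (b - a)) ≡ p * b
        regroup = solve-∀

  -- A balanced weighing matrix with parameters (19, 9, 4)

  infix 6 _∙_

  _∙_ : ∀ {n} → (Fin n → ℤ) → (Fin n → ℤ) → ℤ
  u ∙ v = ∑ (λ l → u l * v l)

  ∙-comm : ∀ {n} (u v : Fin n → ℤ) → u ∙ v ≡ v ∙ u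
  ∙-comm u v = ∑-cong λ l → ℤ.*-comm (u l) (v l)

  -- β is the inner product of distinct rows: 0 for the signed matrix, and 4 for its
  -- entrywise absolute value.
  record IsSeed (β : ℤ) (R : Fin 5 → Fin 10 → Fin 18 → ℤ) (D : Fin 9 → Fin 18 → ℤ) : Set where
    field
      R∙R-zero  : ∀ r s → R 0F r ∙ R 1F s ≡ 0ℤ
      R∙R-one   : ∀ r s → R 1F r ∙ R 1F s ≡ β + δ r s * (+ 9 - β)
      R∙R-total : ∀ r s → ∑ (λ k → R (suc k) r ∙ R 1F s) * + 2 ≡ + 9 * β
      R∙R       : ∀ k l r s → R k r ∙ R l s ≡ R (k · l) r ∙ R 1F s
      R∙D       : ∀ k r c → R k r ∙ D c ≡ ι k * β
      D∙D       : ∀ c d → D c ∙ D d ≡ (β - 1ℤ) + δ c d * (+ 8 * 1ℤ - (β - 1ℤ))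

  halves : (Fin 9 → ℤ) → (Fin 9 → ℤ) → Fin 18 → ℤ
  halves g h l = [ g , h ]′ (splitAt 9 l)

  -- These are the combinations of the identity, whose coefficient comes first in `v`, and the four
  -- direction matrices. They are symmetric because opposite differences have the same direction.
  develop : Vec ℤ 5 → Fin 9 → Fin 9 → ℤ
  develop v x y = lookup v (χ (x ⊖ y))

  -- With Lᵢ the indicator of x - y having direction i: A = L₁ - L₂, B = L₃ - L₄,
  -- A′ = L₁ + L₂ - I and B′ = L₃ + L₄ - I.  These symmetric matrices commute, and
  -- A B = A A′ = B B′ = 0, which makes both residual parts orthogonal to the derived one.
  A B A′ B′ : Fin 9 → Fin 9 → ℤ
  A  = develop (0ℤ  ∷ 1ℤ ∷ -1ℤ ∷ 0ℤ ∷ 0ℤ  ∷ [])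
  B  = develop (0ℤ  ∷ 0ℤ ∷ 0ℤ  ∷ 1ℤ ∷ -1ℤ ∷ [])
  A′ = develop (-1ℤ ∷ 1ℤ ∷ 1ℤ  ∷ 0ℤ ∷ 0ℤ  ∷ [])
  B′ = develop (-1ℤ ∷ 0ℤ ∷ 0ℤ  ∷ 1ℤ ∷ 1ℤ  ∷ [])

  derived : Fin 9 → Fin 18 → ℤ
  derived x = halves (A x) (B x)

  residual₁ residual₂ : Fin 10 → Fin 18 → ℤ
  residual₁ zero    = halves (λ _ → 1ℤ) (λ _ → 0ℤ)
  residual₁ (suc x) = halves (B x) (B′ x)
  residual₂ zero    = halves (λ _ → 0ℤ) (λ _ → 1ℤ)
  residual₂ (suc x) = halves (A′ x) (A x)

  -- `2F` acts as the sign change. Gram matrices then depend on the product of the labels alone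
  -- because R₁ R₁ᵀ = R₂ R₂ᵀ and R₁ R₂ᵀ is symmetric.
  residual : Fin 5 → Fin 10 → Fin 18 → ℤ
  residual 0F r l = 0ℤ
  residual 1F r l = residual₁ r l
  residual 2F r l = - residual₁ r l
  residual 3F r l = residual₂ r l
  residual 4F r l = - residual₂ r l

  abs : ℤ → ℤ
  abs x = + ∣ x ∣

  signed : IsSeed 0ℤ residual derived
  signed = record
    { R∙R-zero  = from-yes (all? λ r → all? λ s → residual 0F r ∙ residual 1F s ℤ.≟ 0ℤ)
    ; R∙R-one   = from-yes (all? λ r → all? λ s → residual 1F r ∙ residual 1F s ℤ.≟ 0ℤ + δ r s * (+ 9 - 0ℤ))
    ; R∙R-total = from-yes (all? λ r → all? λ s → ∑ (λ k → residual (suc k) r ∙ residual 1F s) * + 2 ℤ.≟ + 9 * 0ℤ)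
    ; R∙R       = from-yes (all? λ k → all? λ l → all? λ r → all? λ s → residual k r ∙ residual l s ℤ.≟ residual (k · l) r ∙ residual 1F s)
    ; R∙D       = from-yes (all? λ k → all? λ r → all? λ c → residual k r ∙ derived c ℤ.≟ ι k * 0ℤ)
    ; D∙D       = from-yes (all? λ c → all? λ d → derived c ∙ derived d ℤ.≟ (0ℤ - 1ℤ) + δ c d * (+ 8 * 1ℤ - (0ℤ - 1ℤ)))
    }

  unsigned : IsSeed (+ 4) (λ k r l → abs (residual k r l)) (λ c l → abs (derived c l))
  unsigned = record
    { R∙R-zero  = from-yes (all? λ r → all? λ s → R 0F r ∙ R 1F s ℤ.≟ 0ℤ)
    ; R∙R-one   = from-yes (all? λ r → all? λ s → R 1F r ∙ R 1F s ℤ.≟ + 4 + δ r s * (+ 9 - + 4))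
    ; R∙R-total = from-yes (all? λ r → all? λ s → ∑ (λ k → R (suc k) r ∙ R 1F s) * + 2 ℤ.≟ + 9 * + 4)
    ; R∙R       = from-yes (all? λ k → all? λ l → all? λ r → all? λ s → R k r ∙ R l s ℤ.≟ R (k · l) r ∙ R 1F s)
    ; R∙D       = from-yes (all? λ k → all? λ r → all? λ c → R k r ∙ D c ℤ.≟ ι k * + 4)
    ; D∙D       = from-yes (all? λ c → all? λ d → D c ∙ D d ℤ.≟ (+ 4 - 1ℤ) + δ c d * (+ 8 * 1ℤ - (+ 4 - 1ℤ)))
    }
    where
    R : Fin 5 → Fin 10 → Fin 18 → ℤ
    R k r l = abs (residual k r l)
    D : Fin 9 → Fin 18 → ℤ
    D c l = abs (derived c l)

  isZeroPM? : ∀ x → Dec (IsZeroPM x)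
  isZeroPM? x = (x ℤ.≟ 0ℤ ⊎-dec x ℤ.≟ 1ℤ) ⊎-dec x ℤ.≟ - 1ℤ

  residual-zeroPM : ∀ k r l → IsZeroPM (residual k r l)
  residual-zeroPM = from-yes (all? λ k → all? λ r → all? λ l → isZeroPM? (residual k r l))

  derived-zeroPM : ∀ c l → IsZeroPM (derived c l)
  derived-zeroPM = from-yes (all? λ c → all? λ l → isZeroPM? (derived c l))

  -- The expanded matrix

  Row : ℕ → Set
  Row m = (Point m × Fin 10) ⊎ Fin (9 ℕ.^ suc m)

  order : ℕ → ℕ
  order m = suc (points (suc m) ℕ.* 18)

  module Expansion (R : Fin 5 → Fin 10 → Fin 18 → ℤ) (D : Fin 9 → Fin 18 → ℤ) (m : ℕ) where

    residualBlocks : Point m → Fin 10 → Fin (points (suc m)) → Fin 18 → ℤ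
    residualBlocks i r j = R (bgw m i j) r

    derivedBlocks : Fin (9 ℕ.^ suc m) → Fin (points (suc m)) → Fin 18 → ℤ
    derivedBlocks x j = D (simplex (suc m) x j)

    expand : Row m → Fin (order m) → ℤ
    expand (inj₁ (i , r)) = bordered 0ℤ (residualBlocks i r)
    expand (inj₂ x)       = bordered 1ℤ (derivedBlocks x)

    module _ {β} (seed : IsSeed β R D) where
      open IsSeed seed

      private
        residual∙residual : ∀ i r i′ s → expand (inj₁ (i , r)) ∙ expand (inj₁ (i′ , s)) ≡
                            ∑ (λ j → R (bgw m i j · bgw m i′ j) r ∙ R 1F s)
        residual∙residual i r i′ s = begin
          expand (inj₁ (i , r)) ∙ expand (inj₁ (i′ , s))
            ≡⟨ ∑-bordered _*_ 0ℤ (residualBlocks i r) 0ℤ (residualBlocks i′ s) ⟩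
          0ℤ + ∑ (λ j → R (bgw m i j) r ∙ R (bgw m i′ j) s)
            ≡⟨ ℤ.+-identityˡ _ ⟩
          ∑ (λ j → R (bgw m i j) r ∙ R (bgw m i′ j) s)
            ≡⟨ ∑-cong (λ j → R∙R (bgw m i j) (bgw m i′ j) r s) ⟩
          ∑ (λ j → R (bgw m i j · bgw m i′ j) r ∙ R 1F s) ∎

        same-point : ∀ i r s → expand (inj₁ (i , r)) ∙ expand (inj₁ (i , s)) ≡ pow9 m * (β + δ r s * (+ 9 - β))
        same-point i r s = begin
          expand (inj₁ (i , r)) ∙ expand (inj₁ (i , s))
            ≡⟨ residual∙residual i r i s ⟩
          ∑ (λ j → R (bgw m i j · bgw m i j) r ∙ R 1F s)
            -- Every element of the Klein group is its own inverse, so all nonzero blocks contribute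
            -- the same.
            ≡⟨ ∑-cong (λ j → square (bgw m i j)) ⟩
          ∑ (λ j → ι (bgw m i j) * (R 1F r ∙ R 1F s))
            ≡⟨ ∑-*ʳ (λ j → ι (bgw m i j)) (R 1F r ∙ R 1F s) ⟩
          ∑ (λ j → ι (bgw m i j)) * (R 1F r ∙ R 1F s)
            ≡⟨ cong₂ _*_ (bgw-weight m i) (R∙R-one r s) ⟩
          pow9 m * (β + δ r s * (+ 9 - β)) ∎
          where
          square : ∀ k → R (k · k) r ∙ R 1F s ≡ ι k * (R 1F r ∙ R 1F s)
          square 0F = R∙R-zero r s
          square 1F = sym (ℤ.*-identityˡ _)
          square 2F = sym (ℤ.*-identityˡ _)
          square 3F = sym (ℤ.*-identityˡ _)
          square 4F = sym (ℤ.*-identityˡ _)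

        -- By `R∙D` each nonzero block contributes β whatever its label and symbol, so only the
        -- weight of the group row matters.
        residual∙derived : ∀ i r x → expand (inj₁ (i , r)) ∙ expand (inj₂ x) ≡ pow9 m * β
        residual∙derived i r x = begin
          expand (inj₁ (i , r)) ∙ expand (inj₂ x)
            ≡⟨ ∑-bordered _*_ 0ℤ (residualBlocks i r) 1ℤ (derivedBlocks x) ⟩
          0ℤ + ∑ (λ j → R (bgw m i j) r ∙ D (simplex (suc m) x j))
            ≡⟨ ℤ.+-identityˡ _ ⟩
          ∑ (λ j → R (bgw m i j) r ∙ D (simplex (suc m) x j))
            ≡⟨ ∑-cong (λ j → R∙D (bgw m i j) r (simplex (suc m) x j)) ⟩
          ∑ (λ j → ι (bgw m i j) * β)
            ≡⟨ ∑-*ʳ (λ j → ι (bgw m i j)) β ⟩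
          ∑ (λ j → ι (bgw m i j)) * β
            ≡⟨ cong (_* β) (bgw-weight m i) ⟩
          pow9 m * β ∎

        derived∙derived : ∀ x y → expand (inj₂ x) ∙ expand (inj₂ y) ≡
                          1ℤ + ∑ (λ j → D (simplex (suc m) x j) ∙ D (simplex (suc m) y j))
        derived∙derived x y = ∑-bordered _*_ 1ℤ (derivedBlocks x) 1ℤ (derivedBlocks y)

      gram-diagonal : ∀ ρ → expand ρ ∙ expand ρ ≡ pow9 (suc m)
      gram-diagonal (inj₁ (i , r)) = begin
        expand (inj₁ (i , r)) ∙ expand (inj₁ (i , r)) ≡⟨ same-point i r r ⟩
        pow9 m * (β + δ r r * (+ 9 - β))                 ≡⟨ cong (λ z → pow9 m * (β + z * (+ 9 - β))) (δ-refl r) ⟩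
        pow9 m * (β + 1ℤ * (+ 9 - β))                    ≡⟨ regroup (pow9 m) β ⟩
        + 9 * pow9 m                                     ≡⟨ sym (pow9-suc m) ⟩
        pow9 (suc m)                                     ∎
        where
        regroup : ∀ p b → p * (b + 1ℤ * (+ 9 - b)) ≡ + 9 * p
        regroup = solve-∀
      gram-diagonal (inj₂ x) = begin
        expand (inj₂ x) ∙ expand (inj₂ x)
          ≡⟨ derived∙derived x x ⟩
        1ℤ + ∑ (λ j → D (simplex (suc m) x j) ∙ D (simplex (suc m) x j))
          ≡⟨ simplex-same (suc m) x {λ c d → D c ∙ D d} {1ℤ} D∙D-same ⟩
        pow9 (suc m) * 1ℤ
          ≡⟨ ℤ.*-identityʳ (pow9 (suc m)) ⟩
        pow9 (suc m) ∎
        where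
        regroup : ∀ b → (b - 1ℤ) + 1ℤ * (+ 8 * 1ℤ - (b - 1ℤ)) ≡ + 8 * 1ℤ
        regroup = solve-∀
        D∙D-same : ∀ c → D c ∙ D c ≡ + 8 * 1ℤ
        D∙D-same c = trans (D∙D c c) (trans (cong (λ z → (β - 1ℤ) + z * (+ 8 * 1ℤ - (β - 1ℤ))) (δ-refl c)) (regroup β))

      gram-off-diagonal : ∀ {ρ ρ′} → ρ ≢ ρ′ → expand ρ ∙ expand ρ′ ≡ pow9 m * β
      gram-off-diagonal {inj₁ (i , r)} {inj₁ (i′ , s)} ρ≢ρ′ with i ≟ₚ i′
      ... | yes refl = begin
        expand (inj₁ (i , r)) ∙ expand (inj₁ (i , s)) ≡⟨ same-point i r s ⟩
        pow9 m * (β + δ r s * (+ 9 - β))                 ≡⟨ cong (λ z → pow9 m * (β + z * (+ 9 - β))) (δ-≢ (ρ≢ρ′ ∘ cong (λ t → inj₁ (i , t)))) ⟩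
        pow9 m * (β + 0ℤ)                                ≡⟨ cong (λ z → pow9 m * z) (ℤ.+-identityʳ β) ⟩
        pow9 m * β                                       ∎
      -- Balance of the group matrix, applied with `f k` equal to `R k r ∙ R 1F s`; `R∙R-total`
      -- supplies the sum over the group.
      ... | no i≢i′ = trans (residual∙residual i r i′ s)
                            (bgw-distinct (λ k → R k r ∙ R 1F s) (R∙R-zero r s) {β} (R∙R-total r s) m i≢i′)
      gram-off-diagonal {inj₁ (i , r)} {inj₂ x} _ = residual∙derived i r x
      gram-off-diagonal {inj₂ x} {inj₁ (i , r)} _ =
        trans (∙-comm (expand (inj₂ x)) (expand (inj₁ (i , r)))) (residual∙derived i r x)
      gram-off-diagonal {inj₂ x} {inj₂ y} x≢y = begin
        expand (inj₂ x) ∙ expand (inj₂ y)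
          ≡⟨ derived∙derived x y ⟩
        1ℤ + ∑ (λ j → D (simplex (suc m) x j) ∙ D (simplex (suc m) y j))
          -- The border entries give u = 1 and the derived rows of different symbols give v = β - 1,
          -- which add up to β.
          ≡⟨ simplex-distinct m (x≢y ∘ cong inj₂) {λ c d → D c ∙ D d} {1ℤ} {β - 1ℤ} D∙D ⟩
        pow9 m * (1ℤ + (β - 1ℤ))
          ≡⟨ regroup (pow9 m) β ⟩
        pow9 m * β ∎
        where
        regroup : ∀ p b → p * (1ℤ + (b - 1ℤ)) ≡ p * b
        regroup = solve-∀

  -- Enumeration of the rows and assembly of the matrix

  bordered-all : ∀ {A : Set} {n k} (Q : A → Set) {a} {g : Fin n → Fin k → A} →
                 Q a → (∀ i j → Q (g i j)) → ∀ c → Q (bordered a g c)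
  bordered-all         Q qa qg zero    = qa
  bordered-all {k = k} Q qa qg (suc c) = uncurry qg (remQuot k c)

  bordered-map : ∀ {A B : Set} {n k} (h : A → B) a (g : Fin n → Fin k → A) c →
                 h (bordered a g c) ≡ bordered (h a) (λ i j → h (g i j)) c
  bordered-map h a g zero    = refl
  bordered-map h a g (suc c) = refl

  Fin-cong : ∀ {m n} → m ≡ n → Fin m ↔ Fin n
  Fin-cong refl = ↔-refl

  -- Reconciles Horner's rule in `points` with the split of `Point` into points at infinity and
  -- affine points.
  points-suc : ∀ n → points (suc n) ≡ points n ℕ.+ 9 ℕ.^ n
  points-suc n = trans (regroup (points n)) (cong (points n ℕ.+_) (1+points*8 n))
    where
    regroup : ∀ p → 1 ℕ.+ p ℕ.* 9 ≡ p ℕ.+ (1 ℕ.+ p ℕ.* 8)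
    regroup = ℕSolver.solve-∀

  -- Eighteen is ten plus eight: ten residual rows for each point, while the eights and the border
  -- count the 9^(m+1) codewords.
  order-split : ∀ m → order m ≡ points (suc m) ℕ.* 10 ℕ.+ 9 ℕ.^ suc m
  order-split m = trans (regroup (points (suc m))) (cong (points (suc m) ℕ.* 10 ℕ.+_) (1+points*8 (suc m)))
    where
    regroup : ∀ p → 1 ℕ.+ p ℕ.* 18 ≡ p ℕ.* 10 ℕ.+ (1 ℕ.+ p ℕ.* 8)
    regroup = ℕSolver.solve-∀

  Fin↔Point : ∀ n → Fin (points (suc n)) ↔ Point n
  Fin↔Point zero    = 1↔⊤
  Fin↔Point (suc n) = ↔-trans (Fin-cong (points-suc (suc n))) (↔-trans +↔⊎ (Fin↔Point n ⊎-↔ ↔-refl))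

  Fin↣Row : ∀ m → Fin (order m) ↣ Row m
  Fin↣Row m = ↔⇒↣ (↔-trans (Fin-cong (order-split m))
                   (↔-trans +↔⊎ (↔-trans *↔× (Fin↔Point m ×-↔ ↔-refl) ⊎-↔ ↔-refl)))

  idM-refl : ∀ {v} (i : Fin v) → idM i i ≡ 1ℤ
  idM-refl zero    = refl
  idM-refl (suc i) = idM-refl i

  idM-≢ : ∀ {v} {i j : Fin v} → i ≢ j → idM i j ≡ 0ℤ
  idM-≢ {i = zero}  {zero}  i≢j = contradiction refl i≢j
  idM-≢ {i = zero}  {suc j} i≢j = refl
  idM-≢ {i = suc i} {zero}  i≢j = refl
  idM-≢ {i = suc i} {suc j} i≢j = idM-≢ (i≢j ∘ cong suc)

  two-valued : ∀ {v} (G : Matrix v) {a b} → (∀ i → G i i ≡ a) → (∀ {i j} → i ≢ j → G i j ≡ b) →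
               ∀ i j → G i j ≡ (a - b) * idM i j + b * allOnes i j
  two-valued G {a} {b} diagonal off-diagonal i j with i ≟ j
  ... | yes refl = trans (diagonal i) (trans (on a b) (cong (λ z → (a - b) * z + b * 1ℤ) (sym (idM-refl i))))
    where
    on : ∀ a b → a ≡ (a - b) * 1ℤ + b * 1ℤ
    on = solve-∀
  ... | no i≢j   = trans (off-diagonal i≢j) (trans (off a b) (cong (λ z → (a - b) * z + b * 1ℤ) (sym (idM-≢ i≢j))))
    where
    off : ∀ a b → b ≡ (a - b) * 0ℤ + b * 1ℤ
    off = solve-∀

  fromGram : ∀ {v} k l (W : Matrix v) → (∀ i j → IsZeroPM (W i j)) →
             (∀ i → mulT W W i i ≡ + k) → (∀ {i j} → i ≢ j → mulT W W i j ≡ 0ℤ) →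
             (∀ i → mulT (absM W) (absM W) i i ≡ + k) → (∀ {i j} → i ≢ j → mulT (absM W) (absM W) i j ≡ + l) →
             IsBalancedWeighingMatrix v k l W
  fromGram k l W zeroPM d₁ o₁ d₂ o₂ =
    (zeroPM , λ i j → trans (two-valued (mulT W W) d₁ o₁ i j) (regroup (+ k) (idM i j))) ,
    two-valued (mulT (absM W) (absM W)) d₂ o₂
    where
    regroup : ∀ a e → (a - 0ℤ) * e + 0ℤ * 1ℤ ≡ a * e
    regroup = solve-∀

  -- The enumeration of the rows is a parameter so that it is never unfolded.
  module _ (m : ℕ) (rows : Fin (order m) ↣ Row m) where

    private
      row : Fin (order m) → Row m
      row = Injection.to rows

      row-≢ : ∀ {i j} → i ≢ j → row i ≢ row j
      row-≢ i≢j = i≢j ∘ Injection.injective rows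

      module S = Expansion residual derived m
      module U = Expansion (λ k r l → abs (residual k r l)) (λ c l → abs (derived c l)) m

      W : Matrix (order m)
      W i = S.expand (row i)

      expand-zeroPM : ∀ ρ c → IsZeroPM (S.expand ρ c)
      expand-zeroPM (inj₁ (i , r)) = bordered-all IsZeroPM (inj₁ (inj₁ refl)) (λ j → residual-zeroPM (bgw m i j) r)
      expand-zeroPM (inj₂ x)       = bordered-all IsZeroPM (inj₁ (inj₂ refl)) (λ j → derived-zeroPM (simplex (suc m) x j))

      abs-expand : ∀ ρ c → abs (S.expand ρ c) ≡ U.expand ρ c
      abs-expand (inj₁ (i , r)) = bordered-map abs 0ℤ (S.residualBlocks i r)
      abs-expand (inj₂ x)       = bordered-map abs 1ℤ (S.derivedBlocks x)

      abs-gram : ∀ i j → mulT (absM W) (absM W) i j ≡ U.expand (row i) ∙ U.expand (row j)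
      abs-gram i j = ∑-cong λ l → cong₂ _*_ (abs-expand (row i) l) (abs-expand (row j) l)

    balanced : BalancedWeighingMatrixExists (order m) (9 ℕ.^ suc m) (4 ℕ.* 9 ℕ.^ m)
    balanced = W , fromGram (9 ℕ.^ suc m) (4 ℕ.* 9 ℕ.^ m) W
      (λ i → expand-zeroPM (row i))
      (λ i → S.gram-diagonal signed (row i))
      (λ i≢j → trans (S.gram-off-diagonal signed (row-≢ i≢j)) (ℤ.*-zeroʳ (pow9 m)))
      (λ i → trans (abs-gram i i) (U.gram-diagonal unsigned (row i)))
      (λ {i} {j} i≢j → trans (abs-gram i j) (trans (U.gram-off-diagonal unsigned (row-≢ i≢j))
        (trans (ℤ.*-comm (pow9 m) (+ 4)) (sym (ℤ.pos-* 4 (9 ℕ.^ m))))))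

  order-formula : ∀ m → order m ≡ 1 ℕ.+ 18 ℕ.* ((9 ℕ.^ suc m ℕ.∸ 1) ℕ./ 8)
  order-formula m = cong suc (trans (ℕ.*-comm (points (suc m)) 18) (cong (18 ℕ.*_) (sym quotient)))
    where
    quotient : (9 ℕ.^ suc m ℕ.∸ 1) ℕ./ 8 ≡ points (suc m)
    quotient = trans (cong (λ q → (q ℕ.∸ 1) ℕ./ 8) (sym (1+points*8 (suc m)))) (ℕ.m*n/n≡m (points (suc m)) 8)

open import Data.Nat using (ℕ; suc; _+_; _*_; _^_; _/_; _∸_; _≤_)
open import Data.Nat.Properties using (+-comm)
open import Relation.Binary.PropositionalEquality using (subst)

mainTheorem1 : (m : ℕ) → 1 ≤ m →
    BalancedWeighingMatrixExists (1 + 18 * ((9 ^ (m + 1) ∸ 1) / 8)) (9 ^ (m + 1)) (4 * 9 ^ m)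
mainTheorem1 m _ =
  subst (λ n → BalancedWeighingMatrixExists (1 + 18 * ((9 ^ n ∸ 1) / 8)) (9 ^ n) (4 * 9 ^ m)) (+-comm 1 m)
    (subst (λ v → BalancedWeighingMatrixExists v (9 ^ suc m) (4 * 9 ^ m)) (order-formula m) (balanced m (Fin↣Row m)))
  where open Construction using (balanced; Fin↣Row; order-formula)
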